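{- Let $\Phi$ be a nonempty finite integral gain graph of order $n$ (that is, with $n\ge 1$ vertices). There exist a positive integer $k$, positive integers $d_1=n>d_2,\ldots,d_k$ (that is, $d_1=n$ and $d_j<n$ for $2\le j\le k$), polynomials $p_j(\lambda)=(\lambda-r_{j1})(\lambda-r_{j2})\cdots(\lambda-r_{jd_j})$ of degree $d_j$ with integral roots $r_{j1}\ge r_{j2}\ge\cdots\ge r_{jd_j}\ge 0$ for $1\le j\le k$ and with $p_1(\lambda)=\lambda^n$, and positive integers $\mu_1=1,\mu_2,\ldots,\mu_k$, such that for every integer $m\ge 0$ $$\chi^{\mathbb Z}_\Phi(m)=m^n+\sum_{\substack{2\le j\le k\\ r_{j1}\le m}}(-1)^{n-d_j}\mu_j\,p_j(m),$$ where $\chi^{\mathbb Z}_\Phi(m)$ is the number of proper integral $m$-colorations of $\Phi$.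
   Context: An integral gain graph $\Phi$ consists of a graph $(V,E)$ (loops and multiple edges allowed) and a gain function $\varphi$ assigning an integer to each oriented edge, with $\varphi(e^{ -1})=-\varphi(e)$ when $e^{ -1}$ is $e$ with the opposite orientation. The order of $\Phi$ is its number of vertices. The notation $g e_{ij}$ means an edge with endpoints $v_i,v_j$ whose gain in the direction from $v_i$ to $v_j$ is $g$. For an integer $m\ge 0$, $[m]=\{1,\dots,m\}$, with $[0]=\varnothing$. An integral $m$-coloration is a function $x:V\to[m]$, $v_i\mapsto x_i$; it is proper if $x_j\ne x_i+g$ for every edge $g e_{ij}$ of $\Phi$.
   Formalization: The formal theorem assumes that no loop of the gain graph has gain 0; with such a loop there are no proper colorations, so the count is 0 for all m while the right side is a monic polynomial of degree n for large m, and the claim fails. -}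

module Defs where

open import Data.Nat using (ℕ; suc; _∸_; _<_)
import Data.Nat as ℕ
open import Data.Integer using (ℤ; +_; +[1+_]; -_; _+_; _-_; _*_; _^_; _≤_; 0ℤ; 1ℤ; -1ℤ)
import Data.Integer.Properties as ℤ
open import Data.Fin using (Fin; zero; suc; toℕ; fromℕ<; finToFun)
import Data.Fin as Fin
import Data.Fin.Properties as Fin
open import Data.List using (length; filter; map; foldr; allFin)
open import Data.Product using (_×_; _,_; proj₁; proj₂)
import Data.Vec.Functional as Vector
open import Relation.Binary.PropositionalEquality using (_≡_; _≢_)
open import Relation.Nullary using (Dec; ¬?; _×-dec_)
open import Relation.Nullary.Decidable using (map′)

data Orientation : Set where
  forward backward : Orientation

opposite : Orientation → Orientation
opposite forward  = backward
opposite backward = forward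

-- An edge has two orientations even when it is a loop, so a loop of gain g is
-- also a loop of gain - g.
record IntegralGainGraph : Set where
  field
    order : ℕ
    size  : ℕ
    ends  : Fin size → Fin order × Fin order

  OrientedEdge : Set
  OrientedEdge = Fin size × Orientation

  infix 9 _⁻¹
  _⁻¹ : OrientedEdge → OrientedEdge
  e ⁻¹ = proj₁ e , opposite (proj₂ e)

  field
    φ         : OrientedEdge → ℤ
    φ-inverse : ∀ e → φ (e ⁻¹) ≡ - φ e

  tail : OrientedEdge → Fin order
  tail (e , forward)  = proj₁ (ends e)
  tail (e , backward) = proj₂ (ends e)

  head : OrientedEdge → Fin order
  head e = tail (e ⁻¹)

open IntegralGainGraph public

-- A loop of gain 0 admits no proper coloration, so χℤ vanishes identically and
-- cannot have the leading term m ^ n; the expansion needs such loops excluded.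
NoZeroLoop : IntegralGainGraph → Set
NoZeroLoop Φ = ∀ e → tail Φ e ≡ head Φ e → φ Φ e ≢ 0ℤ

-- Fin m stands for [m] = {1,…,m}: the element with toℕ c = i is the colour i + 1.
Coloration : IntegralGainGraph → ℕ → Set
Coloration Φ m = Fin (order Φ) → Fin m

colour : ∀ {m} → Fin m → ℤ
colour c = +[1+ toℕ c ]

Proper : ∀ Φ {m} → Coloration Φ m → Set
Proper Φ x = ∀ e → colour (x (head Φ e)) ≢ colour (x (tail Φ e)) + φ Φ e

proper? : ∀ Φ {m} (x : Coloration Φ m) → Dec (Proper Φ x)
proper? Φ x =
  map′ (λ { h (e , forward) → proj₁ (h e) ; h (e , backward) → proj₂ (h e) })
       (λ h e → h (e , forward) , h (e , backward))
       (Fin.all? λ e → ok? (e , forward) ×-dec ok? (e , backward))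
  where
  ok? : ∀ e → Dec (colour (x (head Φ e)) ≢ colour (x (tail Φ e)) + φ Φ e)
  ok? e = ¬? (colour (x (head Φ e)) ℤ.≟ colour (x (tail Φ e)) + φ Φ e)

-- finToFun is the bijection from Fin (m ^ n) onto the functions Fin n → Fin m,
-- so each coloration is counted exactly once.
χℤ : IntegralGainGraph → ℕ → ℕ
χℤ Φ m = length (filter (λ i → proper? Φ {m} (finToFun i)) (allFin (m ℕ.^ order Φ)))

-- The number of polynomials is k = suc k-1 and indices start from 0: zero is
-- j = 1 and suc j runs through 2 ≤ j ≤ k. Polynomials over ℤ are identified
-- with their functions ℤ → ℤ.
record PolynomialFamily (n : ℕ) : Set where
  field
    k-1 : ℕ
    d   : Fin (suc k-1) → ℕ
    d>0 : ∀ j → 0 < d j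
    d₁  : d zero ≡ n
    d<n : ∀ j → d (suc j) < n
    r   : ∀ j → Fin (d j) → ℤ
    r-decreasing : ∀ j {a b} → a Fin.≤ b → r j b ≤ r j a
    r≥0 : ∀ j a → 0ℤ ≤ r j a

  p : Fin (suc k-1) → ℤ → ℤ
  p j t = Vector.foldr _*_ 1ℤ (λ a → t - r j a)

  field
    p₁  : ∀ t → p zero t ≡ t ^ n
    μ   : Fin (suc k-1) → ℕ
    μ>0 : ∀ j → 0 < μ j
    μ₁  : μ zero ≡ 1

  largestRoot : Fin (suc k-1) → ℤ
  largestRoot j = r j (fromℕ< (d>0 j))

  signedSum : ℕ → ℤ
  signedSum m =
    foldr _+_ 0ℤ
      (map (λ j → -1ℤ ^ (n ∸ d (suc j)) * + μ (suc j) * p (suc j) (+ m))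
           (filter (λ j → largestRoot (suc j) ℤ.≤? + m) (allFin k-1)))

open PolynomialFamily public using (signedSum)

-- Allow each vertex v its own window lo_v < x_v ≤ m − hi_v. Deleting and
-- contracting an edge x_i = x_j + g gives χ_Φ = χ_{Φ∖e} − χ_{Φ/e}, where the
-- windows of the two merged vertices are intersected, and χ_{Φ/e} = 0 if a loop
-- of gain 0 arises. Without edges the count is ∏ max(m − (lo_v + hi_v), 0).
-- Contraction lowers the order by one, so the sign of a term is (−1)^(n − d) with
-- d its number of factors, and d = n only for the term with no contraction.
module Submission where

open import Defs
open import Algebra.Bundles using (AbelianGroup; CommutativeRing)
open import Data.Bool using (true; false)
open import Data.Fin using (Fin; zero; suc; toℕ; fromℕ<; finToFun; combine; _↑ˡ_; _↑ʳ_; punchIn)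
import Data.Fin as Fin
import Data.Fin.Properties as Fin
open import Data.Integer using (ℤ; +_; +[1+_]; -[1+_]; -_; _+_; _-_; _*_; _^_; _≤_; _<_; _⊔_; +≤+; +<+; 0ℤ; 1ℤ; -1ℤ)
import Data.Integer.Properties as ℤ
open import Data.Integer.Tactic.RingSolver using (solve-∀)
open import Data.List as List using (List; []; _∷_; _++_; map; foldr; length; filter)
open import Data.List.Membership.Propositional.Properties using (∈-lookup)
open import Data.List.Relation.Binary.Permutation.Propositional.Properties using (↭-length)
import Data.List.Relation.Binary.Permutation.Propositional.Properties as Perm
open import Data.List.Relation.Unary.All as All using (All; []; _∷_; all?)
import Data.List.Relation.Unary.All.Properties as All
open import Data.List.Relation.Unary.Sorted.TotalOrder.Properties using (lookup-mono-≤)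
open import Data.Nat using (ℕ; zero; suc; _∸_; _≥_)
import Data.Nat as ℕ
open import Data.Nat.ListAction using (product)
open import Data.Nat.ListAction.Properties using (product-↭)
import Data.Nat.Properties as ℕ
open import Data.Product using (Σ; ∃; _×_; _,_; proj₁; proj₂)
open import Data.Sum using (_⊎_; inj₁; inj₂)
open import Data.Unit using (⊤; tt)
open import Data.Vec using (Vec; []; _∷_; lookup; tabulate)
import Data.Vec.Functional as Vector
import Data.Vec.Properties as Vec
open import Function using (_∘_; id; _⇔_; mk⇔; Equivalence)
open import Relation.Binary.Bundles using (DecTotalOrder)
import Relation.Binary.Construct.Flip.EqAndOrd as Flip
open import Relation.Binary.PropositionalEquality
  using (_≡_; _≢_; refl; sym; trans; cong; cong₂; subst; subst₂; module ≡-Reasoning)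
open import Relation.Nullary using (Dec; yes; no; ¬_; ¬?; _×-dec_; _because_; contradiction)

open import Algebra.Properties.Group (AbelianGroup.group ℤ.+-0-abelianGroup) using (identityʳ-unique)
open import Algebra.Properties.Semiring.Sum (CommutativeRing.semiring ℤ.+-*-commutativeRing)
  using (sum; sum-syntax; sum-cong-≗; sum-remove; sum-replicate-zero; ∑-comm; ∑-distrib-+; *-distribʳ-sum; *-distribˡ-sum)

≥-decTotalOrder : DecTotalOrder _ _ _
≥-decTotalOrder = Flip.decTotalOrder ℕ.≤-decTotalOrder

open import Data.List.Sort ≥-decTotalOrder using (sort; sort-↭; sort-↗)
open Equivalence using (to; from)

private variable
  P Q : Set
  k m n : ℕ

-- Indicators of decisions and finite sums.

⟦_⟧ : Dec P → ℤ
⟦ true  because _ ⟧ = 1ℤ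
⟦ false because _ ⟧ = 0ℤ

⟦⟧-yes : (P? : Dec P) → P → ⟦ P? ⟧ ≡ 1ℤ
⟦⟧-yes (yes _) _ = refl
⟦⟧-yes (no ¬p) p = contradiction p ¬p

⟦⟧-no : (P? : Dec P) → ¬ P → ⟦ P? ⟧ ≡ 0ℤ
⟦⟧-no (yes p) ¬p = contradiction p ¬p
⟦⟧-no (no _)  _  = refl

⟦⟧-cong : (P → Q) → (Q → P) → (P? : Dec P) (Q? : Dec Q) → ⟦ P? ⟧ ≡ ⟦ Q? ⟧
⟦⟧-cong f g (yes p) Q? = sym (⟦⟧-yes Q? (f p))
⟦⟧-cong f g (no ¬p) Q? = sym (⟦⟧-no Q? (¬p ∘ g))

⟦×⟧ : (P? : Dec P) (Q? : Dec Q) → ⟦ P? ×-dec Q? ⟧ ≡ ⟦ P? ⟧ * ⟦ Q? ⟧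
⟦×⟧ (yes _) (yes _) = refl
⟦×⟧ (yes _) (no _)  = refl
⟦×⟧ (no _)  (yes _) = refl
⟦×⟧ (no _)  (no _)  = refl

⟦⟧-split : (P? : Dec P) (Q? : Dec Q) → ⟦ P? ⟧ ≡ ⟦ ¬? Q? ×-dec P? ⟧ + ⟦ Q? ×-dec P? ⟧
⟦⟧-split (yes _) (yes _) = refl
⟦⟧-split (yes _) (no _)  = refl
⟦⟧-split (no _)  (yes _) = refl
⟦⟧-split (no _)  (no _)  = refl

∑-zero : (f : Fin n → ℤ) → (∀ i → f i ≡ 0ℤ) → sum f ≡ 0ℤ
∑-zero {n} f f≡0 = trans (sum-cong-≗ f≡0) (sum-replicate-zero n)

∑-only : (f : Fin n → ℤ) (c : Fin n) → (∀ i → i ≢ c → f i ≡ 0ℤ) → sum f ≡ f c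
∑-only {suc n} f c f≡0 = begin
  sum f                                 ≡⟨ sum-remove {i = c} f ⟩
  f c + ∑[ i < n ] f (punchIn c i)      ≡⟨ cong (λ s → f c + s) (∑-zero _ λ i → f≡0 _ (Fin.punchInᵢ≢i c i)) ⟩
  f c + 0ℤ                              ≡⟨ ℤ.+-identityʳ (f c) ⟩
  f c                                   ∎
  where open ≡-Reasoning

∑-+ : ∀ k l (f : Fin (k ℕ.+ l) → ℤ) → sum f ≡ ∑[ i < k ] f (i ↑ˡ l) + ∑[ j < l ] f (k ↑ʳ j)
∑-+ zero    l f = sym (ℤ.+-identityˡ _)
∑-+ (suc k) l f = trans (cong (λ s → f zero + s) (∑-+ k l (f ∘ suc))) (sym (ℤ.+-assoc (f zero) _ _))

∑-combine : ∀ k l (f : Fin (k ℕ.* l) → ℤ) → sum f ≡ ∑[ i < k ] ∑[ j < l ] f (combine i j)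
∑-combine zero    l f = refl
∑-combine (suc k) l f = trans (∑-+ l (k ℕ.* l) f) (cong (λ s → ∑[ j < l ] f (j ↑ˡ (k ℕ.* l)) + s) (∑-combine k l _))

-- The recursion lowers all bounds together; truncated subtraction gives 0 for an empty interval.
∑-interval : ∀ m a u → ∑[ i < m ] ⟦ a ℕ.≤? toℕ i ×-dec toℕ i ℕ.<? u ⟧ ≡ + (m ℕ.⊓ u ∸ a)
∑-interval zero    a       u       = cong +_ (sym (ℕ.0∸n≡0 a))
∑-interval (suc m) a       zero    =
  trans (∑-zero {suc m} _ λ i → ⟦⟧-no (a ℕ.≤? toℕ i ×-dec toℕ i ℕ.<? 0) λ ()) (cong +_ (sym (ℕ.0∸n≡0 a)))
∑-interval (suc m) zero    (suc u) =
  cong₂ _+_ (⟦⟧-yes (0 ℕ.≤? 0 ×-dec 0 ℕ.<? suc u) (ℕ.z≤n , ℕ.s≤s ℕ.z≤n))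
    (trans (sum-cong-≗ {m} λ i → ⟦⟧-cong (λ (_ , q) → ℕ.z≤n , ℕ.s≤s⁻¹ q) (λ (_ , q) → ℕ.z≤n , ℕ.s≤s q)
              (0 ℕ.≤? toℕ (suc i) ×-dec toℕ (suc i) ℕ.<? suc u) (0 ℕ.≤? toℕ i ×-dec toℕ i ℕ.<? u))
           (∑-interval m 0 u))
∑-interval (suc m) (suc a) (suc u) = trans
  (cong₂ _+_ (⟦⟧-no (suc a ℕ.≤? 0 ×-dec 0 ℕ.<? suc u) λ ())
    (trans (sum-cong-≗ {m} λ i → ⟦⟧-cong (λ (p , q) → ℕ.s≤s⁻¹ p , ℕ.s≤s⁻¹ q) (λ (p , q) → ℕ.s≤s p , ℕ.s≤s q)
              (suc a ℕ.≤? toℕ (suc i) ×-dec toℕ (suc i) ℕ.<? suc u) (a ℕ.≤? toℕ i ×-dec toℕ i ℕ.<? u))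
           (∑-interval m a u)))
  (ℤ.+-identityˡ _)

-- Windows of colours.

-- `hi` is measured down from `m`, so one pair `lo`, `hi` serves every `m`. The value `x` is an
-- integer because contraction tests shifted colours, which may leave `[m]`.
Window : ℕ → ℕ → ℕ → ℤ → Set
Window m lo hi x = + lo < x × x + + hi ≤ + m

window? : ∀ m lo hi x → Dec (Window m lo hi x)
window? m lo hi x = + lo ℤ.<? x ×-dec x + + hi ℤ.≤? + m

-- As `lo` and `hi` are natural numbers, every window lies inside `[m]`. Hence a shifted colour that
-- passes the window test is itself a colour.
window⇒colour : ∀ lo hi {x} → Window m lo hi x → ∃ λ (c : Fin m) → colour c ≡ x
window⇒colour {m} lo hi {+[1+ i ]} (_ , +≤+ i+hi<m) = fromℕ< i<m , cong +[1+_] (Fin.toℕ-fromℕ< i<m)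
  where i<m = ℕ.m+n≤o⇒m≤o (suc i) i+hi<m
window⇒colour lo hi {+ zero} (+<+ () , _)

∑-window : ∀ m lo hi → ∑[ c < m ] ⟦ window? m lo hi (colour c) ⟧ ≡ + (m ∸ (hi ℕ.+ lo))
∑-window m lo hi = begin
  ∑[ c < m ] ⟦ window? m lo hi (colour c) ⟧
    ≡⟨ sum-cong-≗ {m} (λ c → ⟦⟧-cong
         (λ { (+<+ p , +≤+ q) → ℕ.s≤s⁻¹ p , ℕ.m+n≤o⇒m≤o∸n (suc (toℕ c)) q })
         (λ { (p , q) → +<+ (ℕ.s≤s p) , +≤+ (ℕ.m≤o∸n⇒m+n≤o (suc (toℕ c)) (hi≤m c q) q) })
         (window? m lo hi (colour c)) (lo ℕ.≤? toℕ c ×-dec toℕ c ℕ.<? m ∸ hi)) ⟩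
  ∑[ c < m ] ⟦ lo ℕ.≤? toℕ c ×-dec toℕ c ℕ.<? m ∸ hi ⟧  ≡⟨ ∑-interval m lo (m ∸ hi) ⟩
  + (m ℕ.⊓ (m ∸ hi) ∸ lo)   ≡⟨ cong (λ z → + (z ∸ lo)) (ℕ.m≥n⇒m⊓n≡n (ℕ.m∸n≤m m hi)) ⟩
  + (m ∸ hi ∸ lo)           ≡⟨ cong +_ (ℕ.∸-+-assoc m hi lo) ⟩
  + (m ∸ (hi ℕ.+ lo))       ∎
  where
  open ≡-Reasoning
  -- `toℕ c < m ∸ hi` makes the truncated difference positive, hence genuine.
  hi≤m : ∀ c → suc (toℕ {m} c) ℕ.≤ m ∸ hi → hi ℕ.≤ m
  hi≤m c q = ℕ.<⇒≤ (ℕ.m∸n≢0⇒n<m λ eq → contradiction (subst (suc (toℕ c) ℕ.≤_) eq q) λ ())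

-- A bound shifted by a gain may be negative. It is then weaker than the natural number it is joined
-- with, so 0 can replace it.
clip : ℤ → ℕ
clip (+ n) = n
clip _     = 0

+⊔clip : ∀ a z → + (a ℕ.⊔ clip z) ≡ + a ⊔ z
+⊔clip a (+ _)          = refl
+⊔clip a -[1+ _ ] = cong +_ (ℕ.⊔-identityʳ a)

window-⊔ : ∀ {m} a b z w {x} →
  Window m (a ℕ.⊔ clip z) (b ℕ.⊔ clip w) x ⇔ (Window m a b x × z < x × x + w ≤ + m)
window-⊔ {m} a b z w {x} rewrite +⊔clip a z | +⊔clip b w = mk⇔
  (λ (p , q) →
    ( ℤ.≤-<-trans (ℤ.i≤i⊔j (+ a) z) p
    , ℤ.≤-trans (ℤ.+-monoʳ-≤ x (ℤ.i≤i⊔j (+ b) w)) q)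
    , ℤ.≤-<-trans (ℤ.i≤j⊔i (+ a) z) p
    , ℤ.≤-trans (ℤ.+-monoʳ-≤ x (ℤ.i≤j⊔i (+ b) w)) q)
  (λ ((p , q) , p′ , q′) → ⊔-elim (_< x) (+ a) z p p′ , ⊔-elim (λ y → x + y ≤ + m) (+ b) w q q′)
  where
  ⊔-elim : (S : ℤ → Set) → ∀ y y′ → S y → S y′ → S (y ⊔ y′)
  ⊔-elim S y y′ s s′ with ℤ.⊔-sel y y′
  ... | inj₁ eq = subst S (sym eq) s
  ... | inj₂ eq = subst S (sym eq) s′

-- Sums over all colorations.

-- Vectors can be compared by `≡` without function extensionality, and they expose the colour of the
-- head vertex to pattern matching.
colours : Fin (m ℕ.^ n) → Vec ℤ n
colours {m} {n} i = tabulate λ v → colour (finToFun {m} {n} i v)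

∑ᶜ : ∀ m n → (Vec ℤ n → ℤ) → ℤ
∑ᶜ m n F = ∑[ i < m ℕ.^ n ] F (colours {m} {n} i)

colours-combine : ∀ (c : Fin m) (i : Fin (m ℕ.^ n)) →
  colours {m} {suc n} (combine c i) ≡ colour c ∷ colours {m} {n} i
colours-combine {m} {n} c i = cong₂ _∷_
  (cong (colour ∘ proj₁) (Fin.remQuot-combine {m} {m ℕ.^ n} c i))
  (cong (λ q → colours {m} {n} (proj₂ q)) (Fin.remQuot-combine {m} {m ℕ.^ n} c i))

-- The head colour goes to the inner sum, so that later arguments can fix the coloration `ρ` of the
-- other vertices.
∑ᶜ-suc : ∀ m n F → ∑ᶜ m (suc n) F ≡ ∑ᶜ m n λ ρ → ∑[ c < m ] F (colour c ∷ ρ)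
∑ᶜ-suc m n F = begin
  ∑ᶜ m (suc n) F
    ≡⟨ ∑-combine m (m ℕ.^ n) _ ⟩
  ∑[ c < m ] ∑[ i < m ℕ.^ n ] F (colours {m} {suc n} (combine c i))
    ≡⟨ sum-cong-≗ {m} (λ c → sum-cong-≗ {m ℕ.^ n} λ i → cong F (colours-combine c i)) ⟩
  ∑[ c < m ] ∑[ i < m ℕ.^ n ] F (colour c ∷ colours {m} {n} i)
    ≡⟨ ∑-comm {m} {m ℕ.^ n} _ ⟩
  ∑ᶜ m n (λ ρ → ∑[ c < m ] F (colour c ∷ ρ)) ∎
  where open ≡-Reasoning

-- Systems of windows and edges.

-- Only the vertex at the head of a system is ever contracted, and its edges are
-- stored with it: (j , g) in es forbids x₀ = x_j + g. Contracting an edge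
-- intersects windows, so the weight lo + hi of a vertex is the range of gains
-- of the component contracted to it.
data System : ℕ → Set where
  []     : System 0
  vertex : (lo hi : ℕ) (es : List (Fin n × ℤ)) → System n → System (suc n)

Apart : List (Fin n × ℤ) → Vec ℤ n → ℤ → Set
Apart es ρ x = All (λ (j , g) → x ≢ lookup ρ j + g) es

apart? : ∀ (es : List (Fin n × ℤ)) ρ x → Dec (Apart es ρ x)
apart? es ρ x = all? (λ (j , g) → ¬? (x ℤ.≟ lookup ρ j + g)) es

Satisfies : ℕ → System n → Vec ℤ n → Set
Satisfies m []                   ρ       = ⊤
Satisfies m (vertex lo hi es S) (x ∷ ρ) = (Window m lo hi x × Apart es ρ x) × Satisfies m S ρ

satisfies? : ∀ m (S : System n) ρ → Dec (Satisfies m S ρ)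
satisfies? m []                   ρ       = yes tt
satisfies? m (vertex lo hi es S) (x ∷ ρ) =
  (window? m lo hi x ×-dec apart? es ρ x) ×-dec satisfies? m S ρ

count : ℕ → System n → ℤ
count {n} m S = ∑ᶜ m n λ ρ → ⟦ satisfies? m S ρ ⟧

weights : System n → List ℕ
weights []                  = []
weights (vertex lo hi es S) = (hi ℕ.+ lo) ∷ weights S

length-weights : (S : System n) → length (weights S) ≡ n
length-weights []                  = refl
length-weights (vertex lo hi es S) = cong suc (length-weights S)

-- Adding edges and contracting them.

≢-shift : ∀ x y g h → x + g ≢ y + h ⇔ x ≢ y + (h - g)
≢-shift x y g h = mk⇔
  (λ p eq → p (trans (cong (λ z → z + g) eq) (cancel₁ y h g)))
  (λ p eq → p (trans (cancel₂ x g) (trans (cong (λ z → z - g) eq) (ℤ.+-assoc y h (- g)))))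
  where
  cancel₁ : ∀ y h g → y + (h - g) + g ≡ y + h
  cancel₁ = solve-∀
  cancel₂ : ∀ x g → x ≡ x + g - g
  cancel₂ = solve-∀

≢-flip : ∀ x y g → x ≢ y + g ⇔ y ≢ x + - g
≢-flip x y g = mk⇔
  (λ p eq → p (trans (cancel₁ x g) (cong (λ z → z + g) (sym eq))))
  (λ p eq → p (trans (cancel₂ y g) (cong (λ z → z - g) (sym eq))))
  where
  cancel₁ : ∀ x g → x ≡ x + - g + g
  cancel₁ = solve-∀
  cancel₂ : ∀ y g → y ≡ y + g - g
  cancel₂ = solve-∀

-- An edge is stored with its endpoint of smaller index, reversed with negated gain if necessary. A
-- loop of nonzero gain forbids nothing and is dropped.
connect : ∀ (i j : Fin n) g → (i ≡ j → g ≢ 0ℤ) → System n → System n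
connect zero    zero    g ok S                   = S
connect zero    (suc j) g ok (vertex lo hi es S) = vertex lo hi ((j , - g) ∷ es) S
connect (suc i) zero    g ok (vertex lo hi es S) = vertex lo hi ((i , g) ∷ es) S
connect (suc i) (suc j) g ok (vertex lo hi es S) = vertex lo hi es (connect i j g (ok ∘ cong suc) S)

weights-connect : ∀ (i j : Fin n) g ok S → weights (connect i j g ok S) ≡ weights S
weights-connect zero    zero    g ok S                   = refl
weights-connect zero    (suc j) g ok (vertex lo hi es S) = refl
weights-connect (suc i) zero    g ok (vertex lo hi es S) = refl
weights-connect (suc i) (suc j) g ok (vertex lo hi es S) = cong (_ ∷_) (weights-connect i j g (ok ∘ cong suc) S)

satisfies-connect : ∀ (i j : Fin n) g ok S ρ →
  Satisfies m (connect i j g ok S) ρ ⇔ (lookup ρ j ≢ lookup ρ i + g × Satisfies m S ρ)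
satisfies-connect zero zero g ok S (x ∷ ρ) = mk⇔
  (λ s → (λ eq → ok refl (identityʳ-unique x g (sym eq))) , s) proj₂
satisfies-connect zero (suc j) g ok (vertex lo hi es S) (x ∷ ρ) = mk⇔
  (λ { ((w , p ∷ ps) , s) → from (≢-flip _ x g) p , (w , ps) , s })
  (λ { (p , (w , ps) , s) → (w , to (≢-flip _ x g) p ∷ ps) , s })
satisfies-connect (suc i) zero g ok (vertex lo hi es S) (x ∷ ρ) = mk⇔
  (λ { ((w , p ∷ ps) , s) → p , (w , ps) , s })
  (λ { (p , (w , ps) , s) → (w , p ∷ ps) , s })
satisfies-connect (suc i) (suc j) g ok (vertex lo hi es S) (x ∷ ρ) = mk⇔
  (λ (h , s) → let (p , s′) = to E s in p , h , s′)
  (λ (p , h , s) → h , from E (p , s))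
  where E = satisfies-connect i j g (ok ∘ cong suc) S ρ

-- The condition that `x_j + g` lie in the window `lo`, `hi` is pulled back to `x_j` and intersected
-- with the window of `j`.
tighten : Fin n → (lo hi : ℕ) → ℤ → System n → System n
tighten zero    lo hi g (vertex a b es S) = vertex (a ℕ.⊔ clip (+ lo - g)) (b ℕ.⊔ clip (g + + hi)) es S
tighten (suc j) lo hi g (vertex a b es S) = vertex a b es (tighten j lo hi g S)

window-shift : ∀ lo hi g x → Window m lo hi (x + g) ⇔ (+ lo - g < x × x + (g + + hi) ≤ + m)
window-shift lo hi g x = mk⇔
  (λ (p , q) → subst (+ lo - g <_) (cancel₁ x g) (ℤ.+-monoˡ-< (- g) p) , subst (_≤ _) (ℤ.+-assoc x g (+ hi)) q)
  (λ (p , q) → subst (_< x + g) (cancel₂ (+ lo) g) (ℤ.+-monoˡ-< g p) , subst (_≤ _) (sym (ℤ.+-assoc x g (+ hi))) q)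
  where
  cancel₁ : ∀ x g → x + g + - g ≡ x
  cancel₁ = solve-∀
  cancel₂ : ∀ x g → x - g + g ≡ x
  cancel₂ = solve-∀

satisfies-tighten : ∀ (j : Fin n) lo hi g S ρ →
  Satisfies m (tighten j lo hi g S) ρ ⇔ (Window m lo hi (lookup ρ j + g) × Satisfies m S ρ)
satisfies-tighten zero lo hi g (vertex a b es S) (x ∷ ρ) = mk⇔
  (λ ((w , ps) , s) → let (w₁ , w₂) = to E w in from (window-shift lo hi g x) w₂ , (w₁ , ps) , s)
  (λ (w₂ , (w₁ , ps) , s) → (from E (w₁ , to (window-shift lo hi g x) w₂) , ps) , s)
  where E = window-⊔ a b (+ lo - g) (g + + hi) {x}
satisfies-tighten (suc j) lo hi g (vertex a b es S) (x ∷ ρ) = mk⇔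
  (λ (h , s) → let (w , s′) = to E s in w , h , s′)
  (λ (w , h , s) → h , from E (w , s))
  where E = satisfies-tighten j lo hi g S ρ

-- The second alternative occurs when the contraction creates a loop of gain 0.
Representable : ∀ n → (ℕ → Vec ℤ n → Set) → Set
Representable n C = (Σ (System n) λ S → ∀ m ρ → C m ρ ⇔ Satisfies m S ρ) ⊎ (∀ m ρ → ¬ C m ρ)

-- Substituting `x_j + g` for the head colour turns its edge `(i , h)` into an edge of gain `h - g`
-- from `i` to `j`. This is a loop of gain 0 exactly when `(i , h)` duplicates the contracted edge
-- `(j , g)`.
representable-apart : ∀ (j : Fin n) g es S →
  Representable n λ m ρ → Apart es ρ (lookup ρ j + g) × Satisfies m S ρ
representable-apart j g [] S = inj₁ (S , λ m ρ → mk⇔ proj₂ ([] ,_))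
representable-apart j g ((i , h) ∷ es) S with representable-apart j g es S | i Fin.≟ j ×-dec h - g ℤ.≟ 0ℤ
... | inj₂ impossible | _ = inj₂ λ { m ρ (_ ∷ ps , s) → impossible m ρ (ps , s) }
... | inj₁ _ | yes (refl , h-g≡0) = inj₂ λ { m ρ (p ∷ _ , _) → p (cong (λ z → lookup ρ j + z) (sym (ℤ.i-j≡0⇒i≡j h g h-g≡0))) }
... | inj₁ (S′ , E) | no ¬loop = inj₁ (connect i j (h - g) ok S′ , λ m ρ → mk⇔
    (λ { (p ∷ ps , s) → from (D m ρ) (to (≢-shift _ (lookup ρ i) g h) p , to (E m ρ) (ps , s)) })
    (λ s → let (p , s′) = to (D m ρ) s; (ps , s″) = from (E m ρ) s′ in
      from (≢-shift _ (lookup ρ i) g h) p ∷ ps , s″))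
  where
  ok : i ≡ j → h - g ≢ 0ℤ
  ok p q = ¬loop (p , q)
  D : ∀ m ρ → Satisfies m (connect i j (h - g) ok S′) ρ ⇔ (lookup ρ j ≢ lookup ρ i + (h - g) × Satisfies m S′ ρ)
  D m ρ = satisfies-connect i j (h - g) ok S′ ρ

representable-contraction : ∀ (j : Fin n) g lo hi es S → Representable n λ m ρ →
  (Window m lo hi (lookup ρ j + g) × Apart es ρ (lookup ρ j + g)) × Satisfies m S ρ
representable-contraction j g lo hi es S with representable-apart j g es S
... | inj₂ impossible = inj₂ λ m ρ ((_ , ps) , s) → impossible m ρ (ps , s)
... | inj₁ (S′ , E) = inj₁ (tighten j lo hi g S′ , λ m ρ → let D = satisfies-tighten j lo hi g S′ ρ in mk⇔
    (λ ((w , ps) , s) → from D (w , to (E m ρ) (ps , s)))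
    (λ s → let (w , s′) = to D s; (ps , s″) = from (E m ρ) s′ in (w , ps) , s″))

-- Deletion and contraction of counts.

colour-injective : ∀ {c c′ : Fin m} → colour c ≡ colour c′ → c ≡ c′
colour-injective = Fin.toℕ-injective ∘ ℤ.+[1+-injective

-- Injectivity of `colour` leaves at most one nonzero summand; `coloured` supplies its index
-- whenever `Q y` holds.
∑-substitute : ∀ {Q : ℤ → Set} (Q? : ∀ x → Dec (Q x)) y → (Q y → ∃ λ (c : Fin m) → colour c ≡ y) →
  ∑[ c < m ] ⟦ colour c ℤ.≟ y ×-dec Q? (colour c) ⟧ ≡ ⟦ Q? y ⟧
∑-substitute {m} Q? y coloured with Q? y
... | no ¬q = ∑-zero {m} _ λ c → ⟦⟧-no (colour c ℤ.≟ y ×-dec Q? (colour c)) λ { (refl , q) → ¬q q }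
... | yes q with c , refl ← coloured q = trans
  (∑-only {m} _ c λ i i≢c → ⟦⟧-no (colour i ℤ.≟ colour c ×-dec Q? (colour i)) λ (eq , _) → i≢c (colour-injective eq))
  (⟦⟧-yes (colour c ℤ.≟ colour c ×-dec Q? (colour c)) (refl , q))

count-suc : ∀ m (S : System (suc n)) →
  count m S ≡ ∑ᶜ m n λ ρ → ∑[ c < m ] ⟦ satisfies? m S (colour c ∷ ρ) ⟧
count-suc {n} m S = ∑ᶜ-suc m n λ ρ → ⟦ satisfies? m S ρ ⟧

count-isolated : ∀ m lo hi (S : System n) → count m (vertex lo hi [] S) ≡ + (m ∸ (hi ℕ.+ lo)) * count m S
count-isolated {n} m lo hi S = begin
  count m (vertex lo hi [] S)
    ≡⟨ count-suc m (vertex lo hi [] S) ⟩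
  ∑ᶜ m n (λ ρ → ∑[ c < m ] ⟦ satisfies? m (vertex lo hi [] S) (colour c ∷ ρ) ⟧)
    ≡⟨ sum-cong-≗ {m ℕ.^ n} (λ i → inner (colours i)) ⟩
  ∑ᶜ m n (λ ρ → + (m ∸ (hi ℕ.+ lo)) * ⟦ satisfies? m S ρ ⟧)
    ≡⟨ *-distribˡ-sum {m ℕ.^ n} (+ (m ∸ (hi ℕ.+ lo))) _ ⟨
  + (m ∸ (hi ℕ.+ lo)) * count m S ∎
  where
  open ≡-Reasoning
  inner : ∀ ρ → ∑[ c < m ] ⟦ satisfies? m (vertex lo hi [] S) (colour c ∷ ρ) ⟧
              ≡ + (m ∸ (hi ℕ.+ lo)) * ⟦ satisfies? m S ρ ⟧
  inner ρ = begin
    ∑[ c < m ] ⟦ satisfies? m (vertex lo hi [] S) (colour c ∷ ρ) ⟧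
      ≡⟨ sum-cong-≗ {m} (λ c → trans
           (⟦⟧-cong (λ ((w , _) , s) → w , s) (λ (w , s) → (w , []) , s)
             (satisfies? m (vertex lo hi [] S) (colour c ∷ ρ))
             (window? m lo hi (colour c) ×-dec satisfies? m S ρ))
           (⟦×⟧ (window? m lo hi (colour c)) (satisfies? m S ρ))) ⟩
    ∑[ c < m ] (⟦ window? m lo hi (colour c) ⟧ * ⟦ satisfies? m S ρ ⟧)
      ≡⟨ *-distribʳ-sum {m} ⟦ satisfies? m S ρ ⟧ _ ⟨
    (∑[ c < m ] ⟦ window? m lo hi (colour c) ⟧) * ⟦ satisfies? m S ρ ⟧
      ≡⟨ cong (_* ⟦ satisfies? m S ρ ⟧) (∑-window m lo hi) ⟩
    + (m ∸ (hi ℕ.+ lo)) * ⟦ satisfies? m S ρ ⟧ ∎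

contractible? : ∀ m lo hi es (S : System n) (j : Fin n) g ρ →
  Dec ((Window m lo hi (lookup ρ j + g) × Apart es ρ (lookup ρ j + g)) × Satisfies m S ρ)
contractible? m lo hi es S j g ρ =
  (window? m lo hi (lookup ρ j + g) ×-dec apart? es ρ (lookup ρ j + g)) ×-dec satisfies? m S ρ

-- For fixed `ρ`, the head colours allowed without the edge are split by whether they equal
-- `lookup ρ j + g`. Those that differ respect the edge; the one that agrees is determined by `ρ`.
deletion-contraction : ∀ m lo hi j g es (S : System n) →
  count m (vertex lo hi es S)
    ≡ count m (vertex lo hi ((j , g) ∷ es) S) + ∑ᶜ m n λ ρ → ⟦ contractible? m lo hi es S j g ρ ⟧
deletion-contraction {n} m lo hi j g es S = begin
  count m deleted
    ≡⟨ count-suc m deleted ⟩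
  ∑ᶜ m n (λ ρ → ∑[ c < m ] ⟦ satisfies? m deleted (colour c ∷ ρ) ⟧)
    ≡⟨ sum-cong-≗ {m ℕ.^ n} (λ i → inner (colours i)) ⟩
  ∑ᶜ m n (λ ρ → ∑[ c < m ] ⟦ satisfies? m full (colour c ∷ ρ) ⟧ + contracted ρ)
    ≡⟨ ∑-distrib-+ {m ℕ.^ n} _ _ ⟩
  ∑ᶜ m n (λ ρ → ∑[ c < m ] ⟦ satisfies? m full (colour c ∷ ρ) ⟧) + ∑ᶜ m n contracted
    ≡⟨ cong (_+ ∑ᶜ m n contracted) (count-suc m full) ⟨
  count m full + ∑ᶜ m n contracted ∎
  where
  open ≡-Reasoning
  deleted full : System (suc n)
  deleted = vertex lo hi es S
  full    = vertex lo hi ((j , g) ∷ es) S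
  contracted : Vec ℤ n → ℤ
  contracted ρ = ⟦ contractible? m lo hi es S j g ρ ⟧
  inner : ∀ ρ → ∑[ c < m ] ⟦ satisfies? m deleted (colour c ∷ ρ) ⟧
              ≡ ∑[ c < m ] ⟦ satisfies? m full (colour c ∷ ρ) ⟧ + contracted ρ
  inner ρ = begin
    ∑[ c < m ] ⟦ satisfies? m deleted (colour c ∷ ρ) ⟧
      ≡⟨ sum-cong-≗ {m} (λ c → trans
           (⟦⟧-split (satisfies? m deleted (colour c ∷ ρ)) (colour c ℤ.≟ y))
           (cong (λ z → z + ⟦ colour c ℤ.≟ y ×-dec satisfies? m deleted (colour c ∷ ρ) ⟧)
             (⟦⟧-cong (λ (p , (w , ps) , s) → (w , p ∷ ps) , s) (λ { ((w , p ∷ ps) , s) → p , (w , ps) , s })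
               (¬? (colour c ℤ.≟ y) ×-dec satisfies? m deleted (colour c ∷ ρ))
               (satisfies? m full (colour c ∷ ρ))))) ⟩
    ∑[ c < m ] (⟦ satisfies? m full (colour c ∷ ρ) ⟧ + ⟦ colour c ℤ.≟ y ×-dec satisfies? m deleted (colour c ∷ ρ) ⟧)
      ≡⟨ ∑-distrib-+ {m} _ _ ⟩
    ∑[ c < m ] ⟦ satisfies? m full (colour c ∷ ρ) ⟧ + ∑[ c < m ] ⟦ colour c ℤ.≟ y ×-dec satisfies? m deleted (colour c ∷ ρ) ⟧
      ≡⟨ cong (λ z → ∑[ c < m ] ⟦ satisfies? m full (colour c ∷ ρ) ⟧ + z)
           (∑-substitute {m} (λ x → satisfies? m deleted (x ∷ ρ)) y λ ((w , _) , _) → window⇒colour lo hi w) ⟩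
    ∑[ c < m ] ⟦ satisfies? m full (colour c ∷ ρ) ⟧ + contracted ρ ∎
    where y = lookup ρ j + g

-- Signed sums of products.

-- ∏ (m ∸ r) vanishes unless r ≤ m for every root r, so truncated subtraction
-- accounts for the condition r_{j1} ≤ m of the expansion.
∏∸ : ℕ → List ℕ → ℕ
∏∸ m rs = product (map (m ∸_) rs)

term : ℕ → ℕ → List ℕ → ℤ
term n m rs = -1ℤ ^ (n ∸ length rs) * + ∏∸ m rs

total : ℕ → ℕ → List (List ℕ) → ℤ
total n m ts = foldr _+_ 0ℤ (map (term n m) ts)

-- These are the degree bounds on `p_j` for `j ≥ 2`, a list of roots standing for its polynomial.
Admissible : ℕ → List ℕ → Set
Admissible n rs = 0 ℕ.< length rs × length rs ℕ.< n

Expansion : ℕ → (ℕ → ℤ) → Set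
Expansion n f = ∃ λ ts → All (Admissible n) ts × ∀ m → f m ≡ total n m ts

total-++ : ∀ n m ts us → total n m (ts ++ us) ≡ total n m ts + total n m us
total-++ n m []       us = sym (ℤ.+-identityˡ _)
total-++ n m (t ∷ ts) us = trans (cong (λ z → term n m t + z) (total-++ n m ts us)) (sym (ℤ.+-assoc (term n m t) _ _))

-- With `length rs ≤ n` the truncated exponent really grows by one, which flips the sign.
term-suc : ∀ n m rs → length rs ℕ.≤ n → term (suc n) m rs ≡ - term n m rs
term-suc n m rs ≤n rewrite ℕ.+-∸-assoc 1 ≤n = lemma (-1ℤ ^ (n ∸ length rs)) (+ ∏∸ m rs)
  where
  lemma : ∀ x y → -1ℤ * x * y ≡ - (x * y)
  lemma = solve-∀

expansion-resp : ∀ {f g} → (∀ m → f m ≡ g m) → Expansion n g → Expansion n f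
expansion-resp f≡g (ts , ok , g≡) = ts , ok , λ m → trans (f≡g m) (g≡ m)

expansion-0 : Expansion n λ _ → 0ℤ
expansion-0 = [] , [] , λ _ → refl

expansion-+ : ∀ {f g} → Expansion n f → Expansion n g → Expansion n λ m → f m + g m
expansion-+ {n} (ts , ok , f≡) (us , ok′ , g≡) =
  ts ++ us , All.++⁺ ok ok′ , λ m → trans (cong₂ _+_ (f≡ m) (g≡ m)) (sym (total-++ n m ts us))

-- The minus sign of a contraction is absorbed by regarding the same products at order one higher.
expansion-neg : ∀ {f} → Expansion n f → Expansion (suc n) λ m → - f m
expansion-neg {n} (ts , ok , f≡) =
  ts , All.map (λ (0< , <n) → 0< , ℕ.m<n⇒m<1+n <n) ok , λ m → trans (cong -_ (f≡ m)) (lemma m ok)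
  where
  lemma : ∀ m {ts} → All (Admissible n) ts → - total n m ts ≡ total (suc n) m ts
  lemma m []                   = refl
  lemma m {t ∷ ts} ((_ , <n) ∷ ok) = trans (ℤ.neg-distrib-+ (term n m t) (total n m ts))
    (cong₂ _+_ (sym (term-suc n m t (ℕ.<⇒≤ <n))) (lemma m ok))

-- An isolated vertex raises order and degree together, so every sign persists.
expansion-* : ∀ {f} w → Expansion n f → Expansion (suc n) λ m → + (m ∸ w) * f m
expansion-* {n} w (ts , ok , f≡) =
  map (w ∷_) ts , All.map⁺ (All.map (λ (0< , <n) → ℕ.s≤s ℕ.z≤n , ℕ.s≤s <n) ok) ,
  λ m → trans (cong (λ z → + (m ∸ w) * z) (f≡ m)) (lemma m ts)
  where
  term-∷ : ∀ m t → + (m ∸ w) * term n m t ≡ term (suc n) m (w ∷ t)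
  term-∷ m t = trans (swap (+ (m ∸ w)) (-1ℤ ^ (n ∸ length t)) (+ ∏∸ m t))
    (cong (λ z → -1ℤ ^ (n ∸ length t) * z) (sym (ℤ.pos-* (m ∸ w) (∏∸ m t))))
    where
    swap : ∀ x y z → x * (y * z) ≡ y * (x * z)
    swap = solve-∀
  lemma : ∀ m ts → + (m ∸ w) * total n m ts ≡ total (suc n) m (map (w ∷_) ts)
  lemma m []       = ℤ.*-zeroʳ (+ (m ∸ w))
  lemma m (t ∷ ts) = trans (ℤ.*-distribˡ-+ (+ (m ∸ w)) (term n m t) (total n m ts))
    (cong₂ _+_ (term-∷ m t) (lemma m ts))

-- The leading product of a contracted system, of full degree `n`, becomes an admissible term at
-- order `suc n`, with exponent 1.
expansion-∏∸ : ∀ rs → length rs ≡ n → 0 ℕ.< n → Expansion (suc n) λ m → - + ∏∸ m rs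
expansion-∏∸ rs refl 0<n =
  rs ∷ [] , (0<n , ℕ.≤-refl) ∷ [] , λ m → trans (lemma (+ ∏∸ m rs))
    (cong (λ e → -1ℤ ^ e * + ∏∸ m rs + 0ℤ) (sym (ℕ.m+n∸n≡m 1 (length rs))))
  where
  lemma : ∀ x → - x ≡ -1ℤ * x + 0ℤ
  lemma = solve-∀

-- The expansion of a system by induction.

-- The product over `weights S` is the term with no contraction. Its degree is the full order, so it
-- is not admissible and is split off.
Excess : System n → Set
Excess {n} S = Expansion n λ m → count m S - + ∏∸ m (weights S)

-- Induction on the edges at the head vertex. The hypothesis covers all systems of order `n`,
-- because contraction modifies the windows and edges of `S`.
excess-vertex : (∀ (S : System n) → Excess S) → ∀ lo hi es S → Excess (vertex lo hi es S)
excess-vertex excess lo hi [] S = expansion-resp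
  (λ m → trans
    (cong₂ _-_ (count-isolated m lo hi S) (ℤ.pos-* (m ∸ (hi ℕ.+ lo)) (∏∸ m (weights S))))
    (factor (+ (m ∸ (hi ℕ.+ lo))) (count m S) (+ ∏∸ m (weights S))))
  (expansion-* (hi ℕ.+ lo) (excess S))
  where
  factor : ∀ x y z → x * y - x * z ≡ x * (y - z)
  factor = solve-∀
excess-vertex {n} excess lo hi ((j , g) ∷ es) S = split (representable-contraction j g lo hi es S)
  where
  contracted : ℕ → ℤ
  contracted m = ∑ᶜ m n λ ρ → ⟦ contractible? m lo hi es S j g ρ ⟧
  -- Weights ignore edges, so `W` is the leading product both with and without the edge `(j , g)`.
  W : ℕ → ℤ
  W m = + ∏∸ m (weights (vertex lo hi es S))
  rearrange : ∀ m → count m (vertex lo hi ((j , g) ∷ es) S) - W m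
                  ≡ (count m (vertex lo hi es S) - W m) + - contracted m
  rearrange m = trans (solved (count m (vertex lo hi ((j , g) ∷ es) S)) (contracted m) (W m))
    (cong (λ z → z - W m + - contracted m) (sym (deletion-contraction m lo hi j g es S)))
    where
    solved : ∀ x y z → x - z ≡ (x + y - z) + - y
    solved = solve-∀
  expansion : Expansion (suc n) (λ m → - contracted m) → Excess (vertex lo hi ((j , g) ∷ es) S)
  expansion e = expansion-resp rearrange (expansion-+ (excess-vertex excess lo hi es S) e)
  split : _ → Excess (vertex lo hi ((j , g) ∷ es) S)
  split (inj₂ impossible) = expansion (expansion-resp
    (λ m → cong -_ (∑-zero {m ℕ.^ n} _ λ i → ⟦⟧-no (contractible? m lo hi es S j g (colours i)) (impossible m _)))
    expansion-0)
  split (inj₁ (S′ , E)) = expansion (expansion-resp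
    (λ m → trans
      (cong -_ (sum-cong-≗ {m ℕ.^ n} λ i → ⟦⟧-cong (to (E m (colours i))) (from (E m (colours i)))
        (contractible? m lo hi es S j g (colours i)) (satisfies? m S′ (colours i))))
      (split-off (count m S′) (+ ∏∸ m (weights S′))))
    -- The existence of the vertex `j` gives `0 < n`, hence a positive degree for the leading
    -- product of `S′`.
    (expansion-+ (expansion-neg (excess S′)) (expansion-∏∸ (weights S′) (length-weights S′) (0<n j))))
    where
    split-off : ∀ x y → - x ≡ - (x - y) + - y
    split-off = solve-∀
    0<n : ∀ {n} → Fin n → 0 ℕ.< n
    0<n {suc n} _ = ℕ.s≤s ℕ.z≤n

-- The recursion descends on the implicit order, since a contracted system need not be a subterm.
excess : (S : System n) → Excess S
excess []                  = expansion-0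
excess (vertex lo hi es S) = excess-vertex excess lo hi es S

-- The system of a gain graph.

unconstrained : ∀ n → System n
unconstrained zero    = []
unconstrained (suc n) = vertex 0 0 [] (unconstrained n)

∏∸-unconstrained : ∀ m n → + ∏∸ m (weights (unconstrained n)) ≡ (+ m) ^ n
∏∸-unconstrained m zero    = refl
∏∸-unconstrained m (suc n) =
  trans (ℤ.pos-* m _) (cong (λ z → + m * z) (∏∸-unconstrained m n))

satisfies-unconstrained : ∀ (x : Fin n → Fin m) → Satisfies m (unconstrained n) (tabulate (colour ∘ x))
satisfies-unconstrained {zero}  x = tt
satisfies-unconstrained {suc n} {m} x =
  ((+<+ (ℕ.s≤s ℕ.z≤n) , subst (_≤ + m) (sym (ℤ.+-identityʳ (colour (x zero)))) (+≤+ (Fin.toℕ<n (x zero)))) , []) ,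
  satisfies-unconstrained (x ∘ suc)

connectAll : (ends : Fin k → Fin n × Fin n) (gain : Fin k → ℤ) →
  (∀ e → proj₁ (ends e) ≡ proj₂ (ends e) → gain e ≢ 0ℤ) → System n
connectAll {zero}  {n} ends gain ok = unconstrained n
connectAll {suc k} {n} ends gain ok =
  connect (proj₁ (ends zero)) (proj₂ (ends zero)) (gain zero) (ok zero)
    (connectAll (ends ∘ suc) (gain ∘ suc) (ok ∘ suc))

weights-connectAll : ∀ (ends : Fin k → Fin n × Fin n) gain ok →
  weights (connectAll ends gain ok) ≡ weights (unconstrained n)
weights-connectAll {zero}  ends gain ok = refl
weights-connectAll {suc k} ends gain ok =
  trans (weights-connect (proj₁ (ends zero)) (proj₂ (ends zero)) (gain zero) (ok zero) _)
        (weights-connectAll (ends ∘ suc) (gain ∘ suc) (ok ∘ suc))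

satisfies-connectAll : ∀ (ends : Fin k → Fin n × Fin n) gain ok ρ → Satisfies m (connectAll ends gain ok) ρ ⇔
  ((∀ e → lookup ρ (proj₂ (ends e)) ≢ lookup ρ (proj₁ (ends e)) + gain e) × Satisfies m (unconstrained n) ρ)
satisfies-connectAll {zero}  ends gain ok ρ = mk⇔ (λ s → (λ ()) , s) proj₂
satisfies-connectAll {suc k} ends gain ok ρ = mk⇔
  (λ s → let (p , s′) = to D s; (ps , s″) = to E s′ in (λ { zero → p ; (suc e) → ps e }) , s″)
  (λ (ps , s) → from D (ps zero , from E (ps ∘ suc , s)))
  where
  D = satisfies-connect (proj₁ (ends zero)) (proj₂ (ends zero)) (gain zero) (ok zero) _ ρ
  E = satisfies-connectAll (ends ∘ suc) (gain ∘ suc) (ok ∘ suc) ρ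

length-filter-tabulate : ∀ {A : Set} {P : A → Set} (P? : ∀ a → Dec (P a)) (h : Fin k → A) →
  + length (filter P? (List.tabulate h)) ≡ ∑[ i < k ] ⟦ P? (h i) ⟧
length-filter-tabulate {zero}  P? h = refl
length-filter-tabulate {suc k} P? h with P? (h zero) | length-filter-tabulate P? (h ∘ suc)
... | yes _ | eq = cong (λ z → 1ℤ + z) eq
... | no _  | eq = trans eq (sym (ℤ.+-identityˡ _))

-- Turning the filter into an indicator factor lets the condition on the largest root be handled in
-- each summand separately.
foldr-filter-tabulate : ∀ {A : Set} {P : A → Set} (P? : ∀ a → Dec (P a)) (f : A → ℤ) (h : Fin k → A) →
  foldr _+_ 0ℤ (map f (filter P? (List.tabulate h))) ≡ ∑[ i < k ] (⟦ P? (h i) ⟧ * f (h i))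
foldr-filter-tabulate {zero}  P? f h = refl
foldr-filter-tabulate {suc k} P? f h with P? (h zero) | foldr-filter-tabulate P? f (h ∘ suc)
... | yes _ | eq = cong₂ _+_ (sym (ℤ.*-identityˡ (f (h zero)))) eq
... | no _  | eq = trans eq (sym (ℤ.+-identityˡ _))

module _ (Φ : IntegralGainGraph) (ok : NoZeroLoop Φ) where

  system : System (order Φ)
  system = connectAll (ends Φ) (λ e → φ Φ (e , forward)) (λ e → ok (e , forward))

  -- Only forward orientations are stored; by `φ-inverse` the backward condition is the forward one
  -- rearranged.
  proper⇔satisfies : ∀ (x : Coloration Φ m) → Proper Φ x ⇔ Satisfies m system (tabulate (colour ∘ x))
  proper⇔satisfies {m} x = mk⇔
    (λ p → from E ((λ e → subst₂ (λ a b → a ≢ b + φ Φ (e , forward)) (sym (at _)) (sym (at _)) (p (e , forward)))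
                  , satisfies-unconstrained x))
    (λ s → λ { (e , forward)  → forwards s e
             ; (e , backward) → subst (λ g → X (proj₁ (ends Φ e)) ≢ X (proj₂ (ends Φ e)) + g) (sym (φ-inverse Φ (e , forward)))
                 (to (≢-flip _ _ (φ Φ (e , forward))) (forwards s e)) })
    where
    X : Fin (order Φ) → ℤ
    X = colour ∘ x
    at : ∀ v → lookup (tabulate X) v ≡ X v
    at = Vec.lookup∘tabulate X
    E = satisfies-connectAll {m = m} (ends Φ) (λ e → φ Φ (e , forward)) (λ e → ok (e , forward)) (tabulate X)
    forwards : Satisfies m system (tabulate X) →
      ∀ e → X (proj₂ (ends Φ e)) ≢ X (proj₁ (ends Φ e)) + φ Φ (e , forward)
    forwards s e = subst₂ (λ a b → a ≢ b + φ Φ (e , forward)) (at _) (at _) (proj₁ (to E s) e)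

  χℤ≡count : ∀ m → + χℤ Φ m ≡ count m system
  χℤ≡count m = trans (length-filter-tabulate (λ i → proper? Φ {m} (finToFun i)) id)
    (sum-cong-≗ {m ℕ.^ order Φ} λ i → let E = proper⇔satisfies {m} (finToFun i) in
      ⟦⟧-cong (to E) (from E) (proper? Φ (finToFun i)) (satisfies? m system (colours i)))

  leading : ∀ m → + ∏∸ m (weights system) ≡ (+ m) ^ order Φ
  leading m = trans
    (cong (λ ws → + ∏∸ m ws) (weights-connectAll (ends Φ) (λ e → φ Φ (e , forward)) (λ e → ok (e , forward))))
    (∏∸-unconstrained m (order Φ))

-- From an expansion to a polynomial family.

total≡∑ : ∀ n m ts → total n m ts ≡ ∑[ i < length ts ] term n m (List.lookup ts i)
total≡∑ n m []       = refl
total≡∑ n m (t ∷ ts) = cong (λ z → term n m t + z) (total≡∑ n m ts)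

length-sort : ∀ rs → length (sort rs) ≡ length rs
length-sort rs = ↭-length (sort-↭ rs)

∏∸-sort : ∀ m rs → ∏∸ m (sort rs) ≡ ∏∸ m rs
∏∸-sort m rs = product-↭ (Perm.map⁺ (m ∸_) (sort-↭ rs))

sort-decreasing : ∀ rs {a b : Fin (length (sort rs))} → a Fin.≤ b → List.lookup (sort rs) b ℕ.≤ List.lookup (sort rs) a
sort-decreasing rs = lookup-mono-≤ (DecTotalOrder.totalOrder ≥-decTotalOrder) (sort-↗ rs)

∏-roots≤ : ∀ {m} rs → (∀ a → List.lookup rs a ℕ.≤ m) →
  Vector.foldr _*_ 1ℤ (λ a → + m - + List.lookup rs a) ≡ + ∏∸ m rs
∏-roots≤     []       r≤m = refl
∏-roots≤ {m} (r ∷ rs) r≤m = trans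
  (cong₂ _*_ (trans (ℤ.m-n≡m⊖n m r) (ℤ.⊖-≥ (r≤m zero))) (∏-roots≤ rs (r≤m ∘ suc)))
  (sym (ℤ.pos-* (m ∸ r) (∏∸ m rs)))

∏∸-root> : ∀ {m} rs a → m ℕ.< List.lookup rs a → ∏∸ m rs ≡ 0
∏∸-root> {m} (r ∷ rs) zero    m<r rewrite ℕ.m≤n⇒m∸n≡0 (ℕ.<⇒≤ m<r) = refl
∏∸-root> {m} (r ∷ rs) (suc a) m<r rewrite ∏∸-root> rs a m<r = ℕ.*-zeroʳ (m ∸ r)

module _ {n : ℕ} (0<n : 0 ℕ.< n) {f : ℕ → ℤ} (E : Expansion n f) where

  private
    ts = proj₁ E

    t : Fin (length ts) → List ℕ
    -- Sorting puts the roots in decreasing order and preserves degree and product.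
    t i = sort (List.lookup ts i)

    admissible : ∀ i → Admissible n (t i)
    admissible i = subst (λ l → 0 ℕ.< l × l ℕ.< n) (sym (length-sort _)) (All.lookup (proj₁ (proj₂ E)) (∈-lookup i))

  family : PolynomialFamily n
  family = record
    { k-1 = length ts
    ; d   = λ { zero → n ; (suc i) → length (t i) }
    ; d>0 = λ { zero → 0<n ; (suc i) → proj₁ (admissible i) }
    ; d₁  = refl
    ; d<n = λ i → proj₂ (admissible i)
    ; r   = λ { zero a → 0ℤ ; (suc i) a → + List.lookup (t i) a }
    ; r-decreasing = λ { zero _ → ℤ.≤-refl ; (suc i) a≤b → +≤+ (sort-decreasing (List.lookup ts i) a≤b) }
    ; r≥0 = λ { zero a → ℤ.≤-refl ; (suc i) a → +≤+ ℕ.z≤n }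
    ; p₁  = ∏-t-0 n
    ; μ   = λ _ → 1
    -- Equal polynomials may recur in the family, so they are not collected and every multiplicity
    -- is 1.
    ; μ>0 = λ _ → ℕ.s≤s ℕ.z≤n
    ; μ₁  = refl
    }
    where
    ∏-t-0 : ∀ n x → Vector.foldr _*_ 1ℤ {n} (λ _ → x - 0ℤ) ≡ x ^ n
    ∏-t-0 zero    x = refl
    ∏-t-0 (suc n) x = cong₂ _*_ (ℤ.+-identityʳ x) (∏-t-0 n x)

  open PolynomialFamily family using (largestRoot; p; d)

  -- If the largest root exceeds `m`, the indicator is 0 and the truncated product has a zero
  -- factor. Otherwise all roots are at most `m`, because the first is the largest, and truncated
  -- differences agree with integer ones.
  summand : ∀ m i →
    ⟦ largestRoot (suc i) ℤ.≤? + m ⟧ * (-1ℤ ^ (n ∸ d (suc i)) * 1ℤ * p (suc i) (+ m)) ≡ term n m (t i)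
  summand m i with largestRoot (suc i) ℤ.≤? + m
  ... | no ¬≤ = sym (trans
    (cong (λ z → -1ℤ ^ (n ∸ length (t i)) * + z) (∏∸-root> (t i) _ (ℕ.≰⇒> (¬≤ ∘ +≤+))))
    (ℤ.*-zeroʳ (-1ℤ ^ (n ∸ length (t i)))))
  ... | yes (+≤+ ≤m) = trans (ℤ.*-identityˡ _) (cong₂ _*_ (ℤ.*-identityʳ (-1ℤ ^ (n ∸ length (t i)))) (∏-roots≤ (t i) λ a →
    ℕ.≤-trans (sort-decreasing (List.lookup ts i) (first≤ (proj₁ (admissible i)) a)) ≤m))
    where
    first≤ : ∀ {l} (0<l : 0 ℕ.< l) (a : Fin l) → fromℕ< 0<l Fin.≤ a
    first≤ (ℕ.s≤s _) a = ℕ.z≤n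

  signedSum-family : ∀ m → signedSum family m ≡ f m
  signedSum-family m = begin
    signedSum family m
      ≡⟨ foldr-filter-tabulate (λ i → largestRoot (suc i) ℤ.≤? + m)
           (λ i → -1ℤ ^ (n ∸ d (suc i)) * 1ℤ * p (suc i) (+ m)) id ⟩
    ∑[ i < length ts ] (⟦ largestRoot (suc i) ℤ.≤? + m ⟧ * (-1ℤ ^ (n ∸ d (suc i)) * 1ℤ * p (suc i) (+ m)))
      ≡⟨ sum-cong-≗ {length ts} (λ i → trans (summand m i)
           (cong₂ (λ l z → -1ℤ ^ (n ∸ l) * + z) (length-sort (List.lookup ts i)) (∏∸-sort m (List.lookup ts i)))) ⟩
    ∑[ i < length ts ] term n m (List.lookup ts i)
      ≡⟨ total≡∑ n m ts ⟨
    total n m ts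
      ≡⟨ proj₂ (proj₂ E) m ⟨
    f m ∎
    where open ≡-Reasoning

corollary3p2 : (Φ : IntegralGainGraph) → order Φ ≥ 1 → NoZeroLoop Φ →
    Σ (PolynomialFamily (order Φ)) λ P →
    (m : ℕ) → + χℤ Φ m ≡ (+ m) ^ order Φ + signedSum P m
corollary3p2 Φ n≥1 ok = family n≥1 (excess S) , λ m → begin
    + χℤ Φ m                                                     ≡⟨ χℤ≡count Φ ok m ⟩
    count m S                                                    ≡⟨ lemma (count m S) (+ ∏∸ m (weights S)) ⟩
    + ∏∸ m (weights S) + (count m S - + ∏∸ m (weights S))
      ≡⟨ cong₂ _+_ (leading Φ ok m) (sym (signedSum-family n≥1 (excess S) m)) ⟩
    (+ m) ^ order Φ + signedSum (family n≥1 (excess S)) m        ∎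
  where
  open ≡-Reasoning
  S = system Φ ok
  lemma : ∀ x y → x ≡ y + (x - y)
  lemma = solve-∀
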